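{- Let $m$ be a positive integer. If an integer $k\geq 2$ satisfies $k\equiv 1 \pmod{m!/m\#}$, then $N_k > m$. In particular, $\sup_{k\geq 2}N_k=\infty$.
   Context: For each integer $k\geq 2$, the $k$-Göbel sequence $(g_{k,n})_{n\geq 1}$ is the sequence of rational numbers defined by the initial value $g_{k,1}=2$ and the recursion $n\,g_{k,n}=(n-1)\,g_{k,n-1}+g_{k,n-1}^{\,k}$ for $n\geq 2$. Define $N_k := \inf\{n\geq 1 \mid g_{k,n}\notin\mathbb{Z}\}$, with the usual convention $\inf\emptyset=\infty$ (so $N_k\in\mathbb{Z}_{\geq 1}\cup\{\infty\}$). For a positive integer $m$, $m\#$ denotes the primorial of $m$, i.e. the product of all primes $p\leq m$ (equivalently, the radical of $m!$; in particular $1\#=1$). -}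

module Defs where

import Algebra.Definitions.RawSemiring as RawSemiring
open import Data.Integer.Base as ℤ using (+_)
import Data.Integer.Divisibility as ℤ
open import Data.List.Base using (filter; upTo)
import Data.List.Relation.Unary.All as All
open import Data.List.Relation.Unary.All.Properties using (all-filter)
open import Data.Nat.Base as ℕ using (ℕ; zero; suc; 2+; NonZero)
open import Data.Nat.Induction using (<-rec)
open import Data.Nat.ListAction using (product)
open import Data.Nat.ListAction.Properties using (product≢0)
open import Data.Nat.Primality using (prime?; prime⇒nonZero)
open import Data.Nat.Properties using (≤-antisym; ≮⇒≥)
open import Data.Product.Base using (∃-syntax; Σ-syntax; _×_; _,_)
open import Data.Rational.Base as ℚ using (ℚ; _+_; _*_; _/_)
open import Relation.Binary.PropositionalEquality using (_≡_; refl)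
open import Relation.Nullary.Construct.Add.Supremum using (_⁺; [_]; ⊤⁺) public
open import Relation.Nullary.Negation.Core using (¬_; contradiction)
open import Relation.Unary using (Pred; _∈_; _∉_)
import Relation.Binary.Construct.Add.Supremum.NonStrict as NonStrict
import Relation.Binary.Construct.Add.Supremum.Strict as Strict

open RawSemiring ℚ.+-*-rawSemiring using (_^_)

-- ℕ ⁺ is ℕ ∪ {∞}, with ⊤⁺ playing the role of ∞.

open NonStrict ℕ._≤_ public using (_≤⁺_; _≤⊤⁺) renaming ([_] to ≤[_])
open Strict ℕ._<_ public using (_<⁺_)

IsSup : Pred (ℕ ⁺) _ → ℕ ⁺ → Set
IsSup S x = (∀ y → y ∈ S → y ≤⁺ x) × (∀ u → (∀ y → y ∈ S → y ≤⁺ u) → x ≤⁺ u)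

-- The infimum of the empty set is ⊤⁺, the greatest element.
IsInf : Pred (ℕ ⁺) _ → ℕ ⁺ → Set
IsInf S x = (∀ y → y ∈ S → x ≤⁺ y) × (∀ l → (∀ y → y ∈ S → l ≤⁺ y) → l ≤⁺ x)

göbel : (k n : ℕ) → .{{_ : NonZero n}} → ℚ
göbel k 1      = + 2 / 1
göbel k (2+ n) = (+ 1 / 2+ n) * ((+ suc n / 1) * göbel k (suc n) + göbel k (suc n) ^ k)

IsInteger : Pred ℚ _
IsInteger q = ∃[ z ] q ≡ z / 1

NonIntegralIndex : ℕ → Pred (ℕ ⁺) _
NonIntegralIndex k x =
  ∃[ n ] Σ[ n≢0 ∈ NonZero n ] (x ≡ [ n ] × göbel k n {{n≢0}} ∉ IsInteger)

-- IsN k x says that N_k = x.  N_k is given by its graph because a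
-- function ℕ → ℕ ⁺ would have to decide whether some term of the sequence is
-- non-integral.  N-unique and N-¬¬exists below
-- show that the graph is (classically) that of a total function.
IsN : ℕ → Pred (ℕ ⁺) _
IsN k = IsInf (NonIntegralIndex k)

N-unique : ∀ {k x y} → x ∈ IsN k → y ∈ IsN k → x ≡ y
N-unique (lbx , glbx) (lby , glby) = antisym (glby _ lbx) (glbx _ lby)
  where antisym = NonStrict.≤⁺-antisym-≡ ℕ._≤_ ≤-antisym

N-¬¬exists : ∀ k → ¬ ¬ (∃[ x ] x ∈ IsN k)
N-¬¬exists k none =
  none (⊤⁺ , (λ { _ (n , n≢0 , refl , ∉ℤ) → contradiction (n≢0 , ∉ℤ) (integral n) }) ,
        λ l _ → l ≤⊤⁺)
  where
  Bad : Pred ℕ _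
  Bad n = Σ[ n≢0 ∈ NonZero n ] göbel k n {{n≢0}} ∉ IsInteger

  integral : ∀ n → n ∉ Bad
  integral = <-rec (_∉ Bad) λ n ih (n≢0 , ∉ℤ) →
    none ([ n ]
      , (λ { _ (m , m≢0 , refl , m∉ℤ) → ≤[ ≮⇒≥ (λ m<n → ih m<n (m≢0 , m∉ℤ)) ] })
      , λ l lb → lb [ n ] (n , n≢0 , refl , ∉ℤ))

infix 8 _# _#≢0

_# : ℕ → ℕ
m # = product (filter prime? (upTo (suc m)))

_#≢0 : ∀ m → NonZero (m #)
m #≢0 = product≢0 (All.map prime⇒nonZero (all-filter prime? (upTo (suc m))))

infix 4 _≡_[mod_]

_≡_[mod_] : ℕ → ℕ → ℕ → Set
a ≡ b [mod d ] = + d ℤ.∣ (+ a ℤ.- + b)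

{-# OPTIONS --safe #-}

-- Put K = k − 1, so that n gₙ = n gₙ₋₁ + gₙ₋₁ (gₙ₋₁^K − 1).  The modulus m! / m# is the
-- product of the composites up to m; hence, if it divides K and K is even, then K is a
-- multiple of p^(a−1) (p − 1) whenever the prime power p^a divides m!, because p − 1 is
-- composite for p ≥ 5.  So x^K ≡ 1 modulo every divisor Q of m! coprime to x.  By
-- induction on n ≥ 2, gₙ is an integer coprime to Q = m! / n!: from Q ∣ gₙ^K − 1 and
-- Q = (n + 1) Q′ it follows that gₙ₊₁ is an integer congruent to gₙ modulo Q′.  An odd K
-- forces m ≤ 3, and then g₃ is an integer because 3 divides g₂ = 1 + 2^K.

module Submission where

open import Data.Nat.Base using (ℕ; _≤_; _/_; _!)
open import Data.Product.Base using (∃-syntax; _×_)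
open import Defs

import Algebra.Definitions.RawSemiring as RawSemiring
import Algebra.Properties.CommutativeSemiring.Binomial as Binomial
import Algebra.Properties.Semiring.Exp as Exp
import Algebra.Properties.Semiring.Mult as Mult
import Algebra.Properties.Semiring.Sum as Sum
open import Data.Fin.Base as Fin using (Fin; toℕ; fromℕ; inject₁)
open import Data.Fin.Properties using (toℕ-fromℕ; toℕ-inject₁; toℕ<n)
open import Data.Integer.Base as ℤ using ()
import Data.Integer.Properties as ℤ
open import Data.List.Base using ([]; _∷_; _∷ʳ_; filter; upTo)
open import Data.List.Properties using (filter-++; filter-accept; filter-reject; upTo-∷ʳ)
open import Data.List.Relation.Unary.All using (All; []; _∷_)
open import Data.Nat.Base
  using (zero; suc; pred; 2+; _+_; _*_; _^_; _∸_; _<_; z≤n; s≤s; z<s; NonZero; ≢-nonZero; ≢-nonZero⁻¹; >-nonZero⁻¹)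
open import Data.Nat.Combinatorics using (_C_; nCk≡n!/k![n-k]!; k![n∸k]!∣n!; nCn≡1)
open import Data.Nat.Coprimality as Coprime using (Coprime; coprime-divisor; prime⇒coprime)
open import Data.Nat.Divisibility
open import Data.Nat.DivMod using (m*n/n≡m; m/n*n≡m)
open import Data.Nat.ListAction using (product)
open import Data.Nat.ListAction.Properties using (product-++)
open import Data.Nat.Primality
open import Data.Nat.Primality.Factorisation using (factorise; PrimeFactorisation)
open import Data.Nat.Properties
open import Data.Nat.Solver using (module +-*-Solver)
open import Data.Product.Base using (_,_)
open import Data.Rational.Base as ℚ using (ℚ; fromℚᵘ)
import Data.Rational.Properties as ℚ
open import Data.Rational.Unnormalised.Base as ℚᵘ using (mkℚᵘ; *≡*)
import Data.Rational.Unnormalised.Properties as ℚᵘ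
open import Data.Sum.Base using (_⊎_; inj₁; inj₂)
open import Function.Base using (_∘_)
open import Relation.Binary.PropositionalEquality
  using (_≡_; _≢_; refl; sym; trans; cong; cong₂; subst; module ≡-Reasoning)
open import Relation.Nullary using (¬_; yes; no; contradiction)
import Relation.Binary.Construct.Add.Supremum.Strict as Strict

open +-*-Solver using (solve; _:+_; _:*_; _:=_; con)

-- Coprimality and prime powers

coprime-* : ∀ {m n o} → Coprime m o → Coprime n o → Coprime (m * n) o
coprime-* m⊥o n⊥o (d∣mn , d∣o) =
  n⊥o (coprime-divisor (λ (e∣d , e∣m) → m⊥o (e∣m , ∣-trans e∣d d∣o)) d∣mn , d∣o)

coprime-^ : ∀ {m o} a → Coprime m o → Coprime (m ^ a) o
coprime-^ zero    m⊥o = Coprime.1-coprimeTo _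
coprime-^ (suc a) m⊥o = coprime-* m⊥o (coprime-^ a m⊥o)

coprime-*∣ : ∀ {m n k} → Coprime m n → m ∣ k → n ∣ k → m * n ∣ k
coprime-*∣ {m} {n} m⊥n m∣k (divides t refl) =
  *-monoˡ-∣ n (coprime-divisor m⊥n (subst (m ∣_) (*-comm t n) m∣k))

prime∤⇒coprime : ∀ {p n} → Prime p → p ∤ n → Coprime p n
prime∤⇒coprime pr p∤n (d∣p , d∣n) with prime⇒irreducible pr d∣p
... | inj₁ d≡1 = d≡1
... | inj₂ refl = contradiction d∣n p∤n

prime∣prime⇒≡ : ∀ {p q} → Prime p → Prime q → p ∣ q → p ≡ q
prime∣prime⇒≡ pr qr p∣q with prime⇒irreducible qr p∣q
... | inj₁ refl = contradiction pr ¬prime[1]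
... | inj₂ p≡q = p≡q

∃-prime-divisor : ∀ n → n ≢ 0 → n ≢ 1 → ∃[ p ] (Prime p × p ∣ n)
∃-prime-divisor n n≢0 n≢1 with factorise n {{≢-nonZero n≢0}}
... | record { factors = [] ; isFactorisation = eq } = contradiction eq n≢1
... | record { factors = p ∷ ps ; isFactorisation = eq ; factorsPrime = pr ∷ _ } =
  p , pr , subst (p ∣_) (sym eq) (m∣m*n (product ps))

no-common-prime⇒coprime : ∀ {m n} → m ≢ 0 → (∀ {p} → Prime p → p ∣ m → p ∤ n) → Coprime m n
no-common-prime⇒coprime m≢0 h {d} (d∣m , d∣n) with d ≟ 1
... | yes d≡1 = d≡1
... | no d≢1 with ∃-prime-divisor d (λ { refl → m≢0 (0∣⇒≡0 d∣m) }) d≢1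
...   | p , pr , p∣d = contradiction (∣-trans p∣d d∣n) (h pr (∣-trans p∣d d∣m))

-- Local-to-global principle for divisibility, by induction on the list of prime factors of `m`:
-- strip one prime `p` from both sides and pass the hypothesis on to the two quotients.
prime-powers⇒∣ : ∀ m n .{{_ : NonZero m}} →
                 (∀ {p} a → Prime p → p ^ a ∣ m → p ^ a ∣ n) → m ∣ n
prime-powers⇒∣ m n h = subst (_∣ n) (sym isFactorisation)
  (go factors n factorsPrime (λ a pr → h a pr ∘ subst (_ ∣_) (sym isFactorisation)))
  where
  open PrimeFactorisation (factorise m)
  go : ∀ ps n → All Prime ps →
       (∀ {p} a → Prime p → p ^ a ∣ product ps → p ^ a ∣ n) → product ps ∣ n
  go []       n []         h = 1∣ n
  go (p ∷ ps) n (pr ∷ prs) h with p∣n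
    where
    p∣n : p ∣ n
    p∣n = subst (_∣ n) (*-identityʳ p)
      (h 1 pr (subst (_∣ p * product ps) (sym (*-identityʳ p)) (m∣m*n (product ps))))
  ... | divides t refl rewrite *-comm t p = *-monoʳ-∣ p (go ps t prs h′)
    where
    instance _ = prime⇒nonZero pr
    h′ : ∀ {q} a → Prime q → q ^ a ∣ product ps → q ^ a ∣ t
    h′ {q} a qr qᵃ∣ with q ≟ p
    -- For the stripped prime itself the hypothesis is used one exponent higher; for any other `q`,
    -- the power `q ^ a` is coprime to `p`.
    ... | yes refl = *-cancelˡ-∣ p (h (suc a) pr (*-monoʳ-∣ p qᵃ∣))
    ... | no q≢p = coprime-divisor
      (coprime-^ a (prime∤⇒coprime qr (q≢p ∘ prime∣prime⇒≡ qr pr)))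
      (h a qr (∣n⇒∣m*n p qᵃ∣))

coprime-pred : ∀ {p} → Prime p → Coprime p (pred p)
coprime-pred {zero}        pr = contradiction pr ¬prime[0]
coprime-pred {suc zero}    pr = contradiction pr ¬prime[1]
coprime-pred {suc (suc _)} pr = prime⇒coprime pr ≤-refl

prime∤* : ∀ {p m n} → Prime p → p ∤ m → p ∤ n → p ∤ m * n
prime∤* {m = m} {n} pr p∤m p∤n p∣mn with euclidsLemma m n pr p∣mn
... | inj₁ p∣m = p∤m p∣m
... | inj₂ p∣n = p∤n p∣n

prime∣!⇒≤ : ∀ {p} → Prime p → ∀ n → p ∣ n ! → p ≤ n
prime∣!⇒≤ pr zero p∣ = contradiction (subst Prime (∣1⇒≡1 p∣) pr) ¬prime[1]
prime∣!⇒≤ pr (suc n) p∣ with euclidsLemma (suc n) (n !) pr p∣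
... | inj₁ p∣1+n = ∣⇒≤ p∣1+n
... | inj₂ p∣n! = m≤n⇒m≤1+n (prime∣!⇒≤ pr n p∣n!)

prime∣^⇒∣ : ∀ {p} → Prime p → ∀ x n → p ∣ x ^ n → p ∣ x
prime∣^⇒∣ pr x zero p∣ = contradiction (subst Prime (∣1⇒≡1 p∣) pr) ¬prime[1]
prime∣^⇒∣ pr x (suc n) p∣ with euclidsLemma x (x ^ n) pr p∣
... | inj₁ p∣x = p∣x
... | inj₂ p∣xⁿ = prime∣^⇒∣ pr x n p∣xⁿ

-- Fermat's little theorem and its lift to prime powers

infix 4 _≡1[mod_]

-- The witness `r` is y - 1, so no truncated subtraction occurs and `y` is positive by construction.
_≡1[mod_] : ℕ → ℕ → Set
y ≡1[mod d ] = ∃[ r ] (y ≡ suc r × d ∣ r)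

≡1-^ : ∀ {y d} n → y ≡1[mod d ] → y ^ n ≡1[mod d ]
≡1-^ zero    _ = 0 , refl , _ ∣0
≡1-^ (suc n) y≡1@(r , refl , d∣r) with ≡1-^ n y≡1
... | s , eq , d∣s = s + r * suc s , cong (suc r *_) eq , ∣m∣n⇒∣m+n d∣s (∣m⇒∣m*n (suc s) d∣r)

-- The binomial expansion to first order, with all higher terms collected in a multiple of r².
[1+r]^n-expansion : ∀ r n → ∃[ s ] suc r ^ n ≡ suc (n * r + r * r * s)
[1+r]^n-expansion r zero = 0 , cong suc (sym (*-zeroʳ (r * r)))
[1+r]^n-expansion r (suc n) with [1+r]^n-expansion r n
... | s , eq = n + s + r * s , trans (cong (suc r *_) eq)
  (solve 3 (λ r n s → (con 1 :+ r) :* (con 1 :+ (n :* r :+ r :* r :* s)) :=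
      con 1 :+ ((con 1 :+ n) :* r :+ r :* r :* (n :+ s :+ r :* s))) refl r n s)

-- In (1 + r)^p = 1 + p r + r² s, the product p d divides p r because d divides r, and it divides r²
-- because p and d both divide r.
≡1-lift : ∀ {y d p} → p ∣ d → y ≡1[mod d ] → y ^ p ≡1[mod p * d ]
≡1-lift {d = d} {p} p∣d (r , refl , d∣r) with [1+r]^n-expansion r p
... | s , eq = _ , eq , ∣m∣n⇒∣m+n (*-monoʳ-∣ p d∣r) (∣m⇒∣m*n s (*-pres-∣ (∣-trans p∣d d∣r) d∣r))

-- `p` divides p! = (p C k) · k! · (p - k)!, but neither factorial on the right, since both k and p
-- - k are below `p`.
prime∣binomial : ∀ {p k} → Prime p → 0 < k → k < p → p ∣ p C k
prime∣binomial {p} {k} pr 0<k k<p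
  with euclidsLemma (p C k) (k ! * (p ∸ k) !) pr (subst (p ∣_) (sym eq) p∣p!)
  where
  instance
    _ = k !* (p ∸ k) !≢0
  eq : (p C k) * (k ! * (p ∸ k) !) ≡ p !
  eq = trans (cong (_* (k ! * (p ∸ k) !)) (nCk≡n!/k![n-k]! (<⇒≤ k<p)))
             (m/n*n≡m (k![n∸k]!∣n! (<⇒≤ k<p)))
  n∣n! : ∀ n → .{{NonZero n}} → n ∣ n !
  n∣n! (suc n) = m∣m*n (n !)
  p∣p! : p ∣ p !
  p∣p! = n∣n! p {{prime⇒nonZero pr}}
... | inj₁ p∣C = p∣C
... | inj₂ p∣k![p-k]! with euclidsLemma (k !) ((p ∸ k) !) pr p∣k![p-k]!
...   | inj₁ p∣k! = contradiction (prime∣!⇒≤ pr k p∣k!) (<⇒≱ k<p)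
...   | inj₂ p∣[p-k]! = contradiction (prime∣!⇒≤ pr (p ∸ k) p∣[p-k]!) (<⇒≱ (∸-monoʳ-< 0<k (<⇒≤ k<p)))

module _ where
  open Sum +-*-semiring using (sum; sum-init-last)
  open Mult +-*-semiring using () renaming (_×_ to _·_)
  open Exp +-*-semiring using () renaming (_^_ to _↑_)
  open Binomial +-*-commutativeSemiring using (theorem; binomialTerm)

  ↑≡^ : ∀ x n → x ↑ n ≡ x ^ n
  ↑≡^ x zero    = refl
  ↑≡^ x (suc n) = cong (x *_) (↑≡^ x n)

  ·≡* : ∀ n x → n · x ≡ n * x
  ·≡* zero    x = refl
  ·≡* (suc n) x = cong (_+_ x) (·≡* n x)

  ∣sum : ∀ {d} n (f : Fin n → ℕ) → (∀ i → d ∣ f i) → d ∣ sum f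
  ∣sum zero    f d∣f = _ ∣0
  ∣sum (suc n) f d∣f = ∣m∣n⇒∣m+n (d∣f Fin.zero) (∣sum n (f ∘ Fin.suc) (d∣f ∘ Fin.suc))

  freshman : ∀ {p} → Prime p → ∀ x → ∃[ t ] suc x ^ p ≡ suc (x ^ p + p * t)
  freshman {zero} pr x = contradiction pr ¬prime[0]
  freshman {p@(suc q)} pr x with ∣sum q middle middle-∣
    where
    middle : Fin q → ℕ
    -- For `i` in `Fin q` the index runs over 1, ..., p - 1, leaving out the two outer terms.
    middle i = binomialTerm x 1 p (Fin.suc (inject₁ i))
    middle-∣ : ∀ i → p ∣ middle i
    middle-∣ i = subst (p ∣_) (sym (·≡* (p C suc (toℕ (inject₁ i))) _))
      (∣m⇒∣m*n _ (prime∣binomial pr z<s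
         (s≤s (subst (_< q) (sym (toℕ-inject₁ i)) (toℕ<n i)))))
  ... | divides t eq = t , (begin
    suc x ^ p   ≡⟨ cong (_^ p) (+-comm 1 x) ⟩
    (x + 1) ^ p ≡⟨ ↑≡^ (x + 1) p ⟨
    (x + 1) ↑ p ≡⟨ theorem p x 1 ⟩
    first + sum {p} (λ i → binomialTerm x 1 p (Fin.suc i))
      ≡⟨ cong (first +_) (sum-init-last (λ i → binomialTerm x 1 p (Fin.suc i))) ⟩
    first + (sum {q} (λ i → binomialTerm x 1 p (Fin.suc (inject₁ i))) + last)
      ≡⟨ cong₂ _+_ first≡1 (cong₂ _+_ (trans eq (*-comm t p)) last≡xᵖ) ⟩
    1 + (p * t + x ^ p) ≡⟨ cong suc (+-comm (p * t) (x ^ p)) ⟩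
    suc (x ^ p + p * t) ∎)
    where
    open ≡-Reasoning
    first last : ℕ
    first = binomialTerm x 1 p Fin.zero
    last  = binomialTerm x 1 p (Fin.suc (fromℕ q))
    1↑ : ∀ n → 1 ↑ n ≡ 1
    1↑ n = trans (↑≡^ 1 n) (^-zeroˡ n)
    first≡1 : first ≡ 1
    first≡1 = begin
      (p C 0) · (1 * 1 ↑ p) ≡⟨ ·≡* (p C 0) _ ⟩
      (p C 0) * (1 * 1 ↑ p) ≡⟨ cong₂ _*_ (pC0≡1 p) (trans (*-identityˡ (1 ↑ p)) (1↑ p)) ⟩
      1 ∎
      where
      pC0≡1 : ∀ n → n C 0 ≡ 1
      pC0≡1 n = refl
    last≡xᵖ : last ≡ x ^ p
    last≡xᵖ rewrite toℕ-fromℕ q | nCn≡1 p | n∸n≡0 q =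
      trans (+-identityʳ _) (trans (*-identityʳ _) (↑≡^ x p))

  -- Fermat's theorem for every `x`, by induction on `x` with `freshman` as the step.
  x^p≡x+pt : ∀ {p} → Prime p → ∀ x → ∃[ t ] x ^ p ≡ x + p * t
  x^p≡x+pt {zero} pr = contradiction pr ¬prime[0]
  x^p≡x+pt {suc q} pr zero = 0 , sym (*-zeroʳ (suc q))
  x^p≡x+pt {p@(suc _)} pr (suc x) with x^p≡x+pt pr x | freshman pr x
  ... | t , eq | s , eq′ = t + s , trans eq′ (cong suc
      (trans (cong (_+ p * s) eq) (trans (+-assoc x (p * t) (p * s)) (cong (x +_) (sym (*-distribˡ-+ p t s))))))

nonZero⇒suc : ∀ {n} → n ≢ 0 → ∃[ r ] n ≡ suc r
nonZero⇒suc {zero}  n≢0 = contradiction refl n≢0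
nonZero⇒suc {suc r} _   = r , refl

-- Writing x^(p-1) = 1 + r, the previous lemma gives x r = p t, and `p` is coprime to `x`.
fermat : ∀ {p} → Prime p → ∀ {x} → p ∤ x → x ^ pred p ≡1[mod p ]
fermat {zero} pr = contradiction pr ¬prime[0]
fermat {p@(suc q)} pr {x} p∤x with x^p≡x+pt pr x | nonZero⇒suc {x ^ q} xq≢0
  where
  xq≢0 : x ^ q ≢ 0
  xq≢0 eq = p∤x (prime∣^⇒∣ pr x q (subst (p ∣_) (sym eq) (p ∣0)))
... | t , eq | r , eq′ = r , eq′ , coprime-divisor (prime∤⇒coprime pr p∤x)
  (divides t (trans (+-cancelˡ-≡ x _ _ (begin
    x + x * r   ≡⟨ *-suc x r ⟨
    x * suc r   ≡⟨ cong (x *_) eq′ ⟨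
    x * x ^ q   ≡⟨ eq ⟩
    x + p * t   ∎)) (*-comm p t)))
  where open ≡-Reasoning

-- The exponent is Euler's totient of p^(a+1). Fermat starts the induction, and each p-th power
-- gains one factor `p` in the modulus by `≡1-lift`.
euler-prime-power : ∀ {p} → Prime p → ∀ {x} → p ∤ x → ∀ a → x ^ (pred p * p ^ a) ≡1[mod p ^ suc a ]
euler-prime-power {p} pr {x} p∤x zero
  rewrite *-identityʳ (pred p) | *-identityʳ p = fermat pr p∤x
euler-prime-power {p} pr {x} p∤x (suc a) =
  subst (_≡1[mod p ^ 2+ a ]) eq (≡1-lift {p = p} (m∣m*n (p ^ a)) (euler-prime-power pr p∤x a))
  where
  eq : (x ^ (pred p * p ^ a)) ^ p ≡ x ^ (pred p * p ^ suc a)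
  eq = trans (^-*-assoc x (pred p * p ^ a) p) (cong (x ^_)
    (trans (*-assoc (pred p) (p ^ a) p) (cong (pred p *_) (*-comm (p ^ a) p))))

-- Factorials, primorials and compositorials

-- Equal to n ! / n #, but without division.
compositorial : ℕ → ℕ
compositorial zero = 1
compositorial (suc n) with prime? (suc n)
... | yes _ = compositorial n
... | no _  = suc n * compositorial n

#-suc : ∀ m → suc m # ≡ m # * product (filter prime? (suc m ∷ []))
#-suc m = begin
  product (filter prime? (upTo (2+ m)))            ≡⟨ cong (product ∘ filter prime?) (upTo-∷ʳ (suc m)) ⟨
  product (filter prime? (upTo (suc m) ∷ʳ suc m))  ≡⟨ cong product (filter-++ prime? (upTo (suc m)) _) ⟩
  _                                                ≡⟨ product-++ (filter prime? (upTo (suc m))) _ ⟩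
  m # * product (filter prime? (suc m ∷ []))       ∎
  where open ≡-Reasoning

#-prime : ∀ {m} → Prime (suc m) → suc m # ≡ m # * suc m
#-prime {m} pr = trans (#-suc m) (cong (m # *_)
  (trans (cong product (filter-accept prime? {xs = []} pr)) (*-identityʳ (suc m))))

#-nonprime : ∀ {m} → ¬ Prime (suc m) → suc m # ≡ m #
#-nonprime {m} ¬pr = trans (#-suc m)
  (trans (cong (λ ps → m # * product ps) (filter-reject prime? {xs = []} ¬pr)) (*-identityʳ (m #)))

compositorial*#≡! : ∀ m → compositorial m * m # ≡ m !
compositorial*#≡! zero = refl
compositorial*#≡! (suc m) with prime? (suc m)
... | yes pr = begin
  compositorial m * suc m #     ≡⟨ cong (compositorial m *_) (#-prime pr) ⟩
  compositorial m * (m # * suc m) ≡⟨ *-assoc (compositorial m) (m #) (suc m) ⟨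
  compositorial m * m # * suc m ≡⟨ cong (_* suc m) (compositorial*#≡! m) ⟩
  m ! * suc m                   ≡⟨ *-comm (m !) (suc m) ⟩
  suc m !                       ∎
  where open ≡-Reasoning
... | no ¬pr = begin
  suc m * compositorial m * suc m # ≡⟨ cong (suc m * compositorial m *_) (#-nonprime ¬pr) ⟩
  suc m * compositorial m * m #     ≡⟨ *-assoc (suc m) (compositorial m) (m #) ⟩
  suc m * (compositorial m * m #)   ≡⟨ cong (suc m *_) (compositorial*#≡! m) ⟩
  suc m !                           ∎
  where open ≡-Reasoning

!/#≡compositorial : ∀ m → (m ! / m #) {{m #≢0}} ≡ compositorial m
!/#≡compositorial m rewrite sym (compositorial*#≡! m) = m*n/n≡m (compositorial m) (m #) {{m #≢0}}

compositorial≢0 : ∀ m → NonZero (compositorial m)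
compositorial≢0 m = ≢-nonZero λ eq →
  ≢-nonZero⁻¹ (m !) {{m !≢0}} (trans (sym (compositorial*#≡! m)) (cong (_* m #) eq))

nonprime∣compositorial : ∀ {n m} .{{_ : NonZero n}} → ¬ Prime n → n ≤ m → n ∣ compositorial m
nonprime∣compositorial {suc n} {suc m} ¬pr n≤m with prime? (suc m) | suc n ≟ suc m
... | yes pr | yes refl = contradiction pr ¬pr
... | no _   | yes refl = m∣m*n (compositorial m)
... | yes _  | no n≢m   = nonprime∣compositorial ¬pr (≤-pred (≤∧≢⇒< n≤m n≢m))
... | no _   | no n≢m   = ∣n⇒∣m*n (suc m) (nonprime∣compositorial ¬pr (≤-pred (≤∧≢⇒< n≤m n≢m)))

prime∣#⇒≤ : ∀ {p} → Prime p → ∀ m → p ∣ m # → p ≤ m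
prime∣#⇒≤ pr m p∣m# = prime∣!⇒≤ pr m
  (subst (_ ∣_) (compositorial*#≡! m) (∣n⇒∣m*n (compositorial m) p∣m#))

-- Each prime enters the product only once: when `suc m` is adjoined, all prime divisors of `m #`
-- are at most `m`.
#-squarefree : ∀ {p} → Prime p → ∀ m → p ∤ m # ⊎ ∃[ r ] (p ∤ r × m # ≡ p * r)
#-squarefree pr zero = inj₁ λ p∣1 → contradiction (subst Prime (∣1⇒≡1 p∣1) pr) ¬prime[1]
#-squarefree {p} pr (suc m) with prime? (suc m)
... | no ¬pr′ rewrite #-nonprime ¬pr′ = #-squarefree pr m
... | yes pr′ rewrite #-prime pr′ with p ≟ suc m
...   | yes refl = inj₂ (m # , (λ p∣m# → 1+n≰n (prime∣#⇒≤ pr m p∣m#)) , *-comm (m #) (suc m))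
...   | no p≢ with #-squarefree pr m
...     | inj₁ p∤m# = inj₁ (prime∤* pr p∤m# (p≢ ∘ prime∣prime⇒≡ pr pr′))
...     | inj₂ (r , p∤r , eq) = inj₂ (r * suc m , prime∤* pr p∤r (p≢ ∘ prime∣prime⇒≡ pr pr′)
                                     , trans (cong (_* suc m) eq) (*-assoc p r (suc m)))

-- Since m! is the compositorial times `m #`, and `m #` absorbs at most one factor `p`, the
-- remaining `a` factors lie in the compositorial.
prime-power∣compositorial : ∀ {p} → Prime p → ∀ m a → p ^ suc a ∣ m ! → p ^ a ∣ compositorial m
prime-power∣compositorial {p} pr m a p^1+a∣m! with #-squarefree pr m
... | inj₁ p∤m# = coprime-divisor (coprime-^ a (prime∤⇒coprime pr p∤m#))
  (subst (p ^ a ∣_) (trans (sym (compositorial*#≡! m)) (*-comm (compositorial m) (m #)))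
     (m*n∣⇒n∣ p (p ^ a) p^1+a∣m!))
... | inj₂ (r , p∤r , eq) = coprime-divisor (coprime-^ a (prime∤⇒coprime pr p∤r))
  (*-cancelˡ-∣ p {{prime⇒nonZero pr}} (subst (p ^ suc a ∣_) m!≡ p^1+a∣m!))
  where
  open ≡-Reasoning
  m!≡ : m ! ≡ p * (r * compositorial m)
  m!≡ = begin
    m !                         ≡⟨ compositorial*#≡! m ⟨
    compositorial m * m #       ≡⟨ *-comm (compositorial m) (m #) ⟩
    m # * compositorial m       ≡⟨ cong (_* compositorial m) eq ⟩
    p * r * compositorial m     ≡⟨ *-assoc p r (compositorial m) ⟩
    p * (r * compositorial m)   ∎

2∣n⊎2∣1+n : ∀ n → 2 ∣ n ⊎ 2 ∣ suc n
2∣n⊎2∣1+n zero = inj₁ (2 ∣0)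
2∣n⊎2∣1+n (suc n) with 2∣n⊎2∣1+n n
... | inj₁ 2∣n = inj₂ (∣m∣n⇒∣m+n ∣-refl 2∣n)
... | inj₂ 2∣1+n = inj₁ 2∣1+n

-- A prime p ≥ 5 has a composite predecessor, which is a factor of the compositorial.
pred-prime-∣ : ∀ {p m K} → Prime p → p ≤ m → 2 ∣ K → compositorial m ∣ K → pred p ∣ K
pred-prime-∣ {zero} pr = contradiction pr ¬prime[0]
pred-prime-∣ {suc zero} pr = contradiction pr ¬prime[1]
pred-prime-∣ {suc q@(suc _)} {K = K} pr p≤m 2∣K C∣K with prime? q
... | no ¬qr = ∣-trans (nonprime∣compositorial ¬qr (≤-trans (n≤1+n q) p≤m)) C∣K
-- Of the consecutive primes q and q + 1 one is even, hence equal to 2; so `q` is 2, which divides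
-- `K` by hypothesis, or `q` is 1.
... | yes qr with 2∣n⊎2∣1+n q
...   | inj₁ 2∣q = subst (_∣ K) (prime∣prime⇒≡ prime[2] qr 2∣q) 2∣K
...   | inj₂ 2∣p with refl ← prime∣prime⇒≡ prime[2] pr 2∣p = 1∣ _

-- For each prime power p^(a+1) dividing `Q`, the coprime numbers p - 1 and p^a both divide `K`, so
-- their product does and `euler-prime-power` applies. `prime-powers⇒∣` assembles these congruences
-- into one modulo `Q`.
^≡1[mod-∣!] : ∀ m {Q K x} → Q ∣ m ! → 2 ∣ K → compositorial m ∣ K →
              NonZero x → Coprime x Q → x ^ K ≡1[mod Q ]
^≡1[mod-∣!] m {Q} {K} {x} Q∣m! 2∣K C∣K x≢0 x⊥Q
  with nonZero⇒suc (≢-nonZero⁻¹ (x ^ K) {{m^n≢0 x K {{x≢0}}}})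
... | r , eq = r , eq , prime-powers⇒∣ Q r {{Q≢0}} local
  where
  Q≢0 : NonZero Q
  Q≢0 = ≢-nonZero λ { refl → ≢-nonZero⁻¹ (m !) {{m !≢0}} (0∣⇒≡0 Q∣m!) }
  local : ∀ {p} a → Prime p → p ^ a ∣ Q → p ^ a ∣ r
  local zero pr _ = 1∣ r
  local {p@(suc q)} (suc a) pr pᵃ∣Q with
      coprime-*∣ (Coprime.sym (coprime-^ a (coprime-pred pr)))
        (pred-prime-∣ pr (prime∣!⇒≤ pr m (∣-trans p∣Q Q∣m!)) 2∣K C∣K)
        (∣-trans (prime-power∣compositorial pr m a (∣-trans pᵃ∣Q Q∣m!)) C∣K)
    where
    p∣Q : p ∣ Q
    p∣Q = m*n∣⇒m∣ p (p ^ a) pᵃ∣Q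
  ... | divides t eqK with ≡1-^ t (euler-prime-power pr p∤x a)
    where
    p∤x : p ∤ x
    p∤x p∣x = contradiction (subst Prime (x⊥Q (p∣x , m*n∣⇒m∣ p (p ^ a) pᵃ∣Q)) pr) ¬prime[1]
  ...   | s , eqs , pᵃ∣s = subst (p ^ suc a ∣_) s≡r pᵃ∣s
    where
    s≡r : s ≡ r
    s≡r = suc-injective (begin
      suc s                   ≡⟨ eqs ⟨
      (x ^ (q * p ^ a)) ^ t   ≡⟨ ^-*-assoc x (q * p ^ a) t ⟩
      x ^ (q * p ^ a * t)     ≡⟨ cong (x ^_) (trans (*-comm (q * p ^ a) t) (sym eqK)) ⟩
      x ^ K                   ≡⟨ eq ⟩
      suc r                   ∎)
      where open ≡-Reasoning

-- The Göbel sequence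

open RawSemiring ℚ.+-*-rawSemiring using () renaming (_^_ to _^ℚ_)

fromℕ-ℚ : ℕ → ℚ
fromℕ-ℚ n = ℤ.+ n ℚ./ 1

fromℚᵘ-homo-+ : ∀ p q → fromℚᵘ p ℚ.+ fromℚᵘ q ≡ fromℚᵘ (p ℚᵘ.+ q)
fromℚᵘ-homo-+ p q = trans (sym (ℚ.fromℚᵘ-toℚᵘ _)) (ℚ.fromℚᵘ-cong
  (ℚᵘ.≃-trans (ℚ.toℚᵘ-homo-+ (fromℚᵘ p) (fromℚᵘ q)) (ℚᵘ.+-cong (ℚ.toℚᵘ-fromℚᵘ p) (ℚ.toℚᵘ-fromℚᵘ q))))

fromℚᵘ-homo-* : ∀ p q → fromℚᵘ p ℚ.* fromℚᵘ q ≡ fromℚᵘ (p ℚᵘ.* q)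
fromℚᵘ-homo-* p q = trans (sym (ℚ.fromℚᵘ-toℚᵘ _)) (ℚ.fromℚᵘ-cong
  (ℚᵘ.≃-trans (ℚ.toℚᵘ-homo-* (fromℚᵘ p) (fromℚᵘ q)) (ℚᵘ.*-cong (ℚ.toℚᵘ-fromℚᵘ p) (ℚ.toℚᵘ-fromℚᵘ q))))

fromℕ-ℚ-+ : ∀ m n → fromℕ-ℚ m ℚ.+ fromℕ-ℚ n ≡ fromℕ-ℚ (m + n)
fromℕ-ℚ-+ m n = trans (fromℚᵘ-homo-+ (mkℚᵘ (ℤ.+ m) 0) (mkℚᵘ (ℤ.+ n) 0))
  (cong (ℚ._/ 1) (cong₂ ℤ._+_ (ℤ.*-identityʳ (ℤ.+ m)) (ℤ.*-identityʳ (ℤ.+ n))))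

fromℕ-ℚ-* : ∀ m n → fromℕ-ℚ m ℚ.* fromℕ-ℚ n ≡ fromℕ-ℚ (m * n)
fromℕ-ℚ-* m n = trans (fromℚᵘ-homo-* (mkℚᵘ (ℤ.+ m) 0) (mkℚᵘ (ℤ.+ n) 0))
  (cong (ℚ._/ 1) (sym (ℤ.pos-* m n)))

fromℕ-ℚ-^ : ∀ m n → fromℕ-ℚ m ^ℚ n ≡ fromℕ-ℚ (m ^ n)
fromℕ-ℚ-^ m zero    = refl
fromℕ-ℚ-^ m (suc n) = trans (cong (fromℕ-ℚ m ℚ.*_) (fromℕ-ℚ-^ m n)) (fromℕ-ℚ-* m (m ^ n))

1/n*[n*m]≡m : ∀ n m .{{_ : NonZero n}} → (ℤ.+ 1 ℚ./ n) ℚ.* fromℕ-ℚ (n * m) ≡ fromℕ-ℚ m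
1/n*[n*m]≡m n@(suc n-1) m = trans (fromℚᵘ-homo-* (mkℚᵘ (ℤ.+ 1) n-1) (mkℚᵘ (ℤ.+ (n * m)) 0))
  (ℚ.fromℚᵘ-cong {mkℚᵘ (ℤ.+ 1) n-1 ℚᵘ.* mkℚᵘ (ℤ.+ (n * m)) 0} {mkℚᵘ (ℤ.+ m) 0} (*≡* (begin
    ℤ.+ 1 ℤ.* ℤ.+ (n * m) ℤ.* ℤ.+ 1  ≡⟨ ℤ.*-identityʳ _ ⟩
    ℤ.+ 1 ℤ.* ℤ.+ (n * m)            ≡⟨ ℤ.*-identityˡ _ ⟩
    ℤ.+ (n * m)                      ≡⟨ cong ℤ.+_ (trans (*-comm n m) (cong (m *_) (sym (*-identityʳ n)))) ⟩
    ℤ.+ (m * (n * 1))                ≡⟨ ℤ.pos-* m (n * 1) ⟩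
    ℤ.+ m ℤ.* ℤ.+ (n * 1)            ∎)))
  where open ≡-Reasoning

-- Reduces a step of the rational recursion to an equation between natural numbers.
göbel-suc : ∀ k n g g′ → göbel k (suc n) ≡ fromℕ-ℚ g →
            suc n * g + g ^ k ≡ 2+ n * g′ → göbel k (2+ n) ≡ fromℕ-ℚ g′
göbel-suc k n g g′ eq eq′ = begin
  göbel k (2+ n)
    ≡⟨ cong (λ q → (ℤ.+ 1 ℚ./ 2+ n) ℚ.* (fromℕ-ℚ (suc n) ℚ.* q ℚ.+ q ^ℚ k)) eq ⟩
  (ℤ.+ 1 ℚ./ 2+ n) ℚ.* (fromℕ-ℚ (suc n) ℚ.* fromℕ-ℚ g ℚ.+ fromℕ-ℚ g ^ℚ k)
    ≡⟨ cong ((ℤ.+ 1 ℚ./ 2+ n) ℚ.*_) (trans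
         (cong₂ ℚ._+_ (fromℕ-ℚ-* (suc n) g) (fromℕ-ℚ-^ g k))
         (fromℕ-ℚ-+ (suc n * g) (g ^ k))) ⟩
  (ℤ.+ 1 ℚ./ 2+ n) ℚ.* fromℕ-ℚ (suc n * g + g ^ k)
    ≡⟨ cong (λ z → (ℤ.+ 1 ℚ./ 2+ n) ℚ.* fromℕ-ℚ z) eq′ ⟩
  (ℤ.+ 1 ℚ./ 2+ n) ℚ.* fromℕ-ℚ (2+ n * g′)
    ≡⟨ 1/n*[n*m]≡m (2+ n) g′ ⟩
  fromℕ-ℚ g′ ∎
  where open ≡-Reasoning

-- Integrality of the first m terms

göbel₂ : ∀ K → göbel (suc K) 2 ≡ fromℕ-ℚ (suc (2 ^ K))
göbel₂ K = göbel-suc (suc K) 0 2 (suc (2 ^ K)) refl (sym (*-suc 2 (2 ^ K)))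

-- Base case of the coprimality invariant. The prime 2 is excluded because 1 + 2^K is odd for
-- positive `K`. An odd prime p dividing `Q` has 2^K ≡ 1, hence 1 + 2^K ≡ 2 modulo p, which is not
-- 0.
1+2^K⊥ : ∀ m {K Q} .{{_ : NonZero K}} → Q ∣ m ! → 2 ∣ K → compositorial m ∣ K → Coprime (suc (2 ^ K)) Q
1+2^K⊥ m {K@(suc j)} {Q} Q∣m! 2∣K C∣K = no-common-prime⇒coprime (λ ()) no-common-prime
  where
  no-common-prime : ∀ {p} → Prime p → p ∣ suc (2 ^ K) → p ∤ Q
  no-common-prime {p} pr p∣1+2^K p∣Q with p ≟ 2
  ... | yes refl = contradiction (subst Prime (∣1⇒≡1
          (∣m+n∣m⇒∣n (subst (2 ∣_) (+-comm 1 (2 ^ K)) p∣1+2^K) (m∣m*n (2 ^ j)))) pr) ¬prime[1]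
  ... | no p≢2 with ^≡1[mod-∣!] m (∣-trans p∣Q Q∣m!) 2∣K C∣K _
                      (Coprime.sym (prime∤⇒coprime pr (p≢2 ∘ prime∣prime⇒≡ pr prime[2])))
  ...   | r , eq , p∣r = p≢2 (prime∣prime⇒≡ pr prime[2]
            (∣m+n∣m⇒∣n (subst (p ∣_) (trans (cong suc eq) (+-comm 2 r)) p∣1+2^K) p∣r))

göbel-coprime : ∀ m {K} .{{_ : NonZero K}} → 2 ∣ K → compositorial m ∣ K → ∀ n → 2+ n ≤ m →
  ∃[ g ] ∃[ Q ] (göbel (suc K) (2+ n) ≡ fromℕ-ℚ g × m ! ≡ Q * (2+ n) ! × NonZero g × Coprime g Q)
göbel-coprime m {K} 2∣K C∣K zero 2≤m with m≤n⇒m!∣n! 2≤m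
... | divides Q eq = suc (2 ^ K) , Q , göbel₂ K , eq , _ ,
  1+2^K⊥ m (divides 2 (trans eq (*-comm Q 2))) 2∣K C∣K
göbel-coprime m {K} 2∣K C∣K (suc n) 3+n≤m
  with göbel-coprime m 2∣K C∣K n (≤-trans (n≤1+n _) 3+n≤m) | m≤n⇒m!∣n! 3+n≤m
... | g , Q , eq , m!≡ , g≢0 , g⊥Q | divides Q′ m!≡′
  with ^≡1[mod-∣!] m (divides ((2+ n) !) (trans m!≡ (*-comm Q _))) 2∣K C∣K g≢0 g⊥Q
...   | r , gᴷ≡ , divides t r≡ =
  g′ , Q′ , göbel-suc (suc K) (suc n) g g′ eq recursion , m!≡′ , g′≢0 g≢0 , g′⊥Q′
  where
  open ≡-Reasoning
  g′ : ℕ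
  -- With g^K = 1 + t Q and Q = (n + 3) Q′, the numerator (n + 2) g + g · g^K equals (n + 3)(g + g t
  -- Q′).
  g′ = g + g * (t * Q′)
  Q≡ : Q ≡ Q′ * suc (2+ n)
  Q≡ = *-cancelʳ-≡ Q (Q′ * suc (2+ n)) ((2+ n) !) {{(2+ n) !≢0}} (begin
    Q * (2+ n) !                  ≡⟨ m!≡ ⟨
    m !                           ≡⟨ m!≡′ ⟩
    Q′ * (suc (2+ n) * (2+ n) !)  ≡⟨ *-assoc Q′ (suc (2+ n)) _ ⟨
    Q′ * suc (2+ n) * (2+ n) !    ∎)
  recursion : 2+ n * g + g * g ^ K ≡ suc (2+ n) * g′
  recursion = begin
    2+ n * g + g * g ^ K
      ≡⟨ cong (λ z → 2+ n * g + g * z) (trans gᴷ≡ (cong suc (trans r≡ (cong (t *_) Q≡)))) ⟩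
    2+ n * g + g * suc (t * (Q′ * suc (2+ n)))
      ≡⟨ solve 4 (λ n g t Q′ → (con 2 :+ n) :* g :+ g :* (con 1 :+ t :* (Q′ :* (con 3 :+ n)))
                := (con 3 :+ n) :* (g :+ g :* (t :* Q′))) refl n g t Q′ ⟩
    suc (2+ n) * g′ ∎
  g′≢0 : NonZero g → NonZero g′
  g′≢0 g≢0 = ≢-nonZero λ g′≡0 → ≢-nonZero⁻¹ g {{g≢0}} (m+n≡0⇒m≡0 g g′≡0)
  g′⊥Q′ : Coprime g′ Q′
  -- As g′ ≡ g modulo Q′ and Q′ divides Q, a common divisor of g′ and Q′ also divides g and Q.
  g′⊥Q′ {d} (d∣g′ , d∣Q′) = g⊥Q
    ( ∣m+n∣m⇒∣n (subst (d ∣_) (+-comm g _) d∣g′) (∣n⇒∣m*n g (∣n⇒∣m*n t d∣Q′))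
    , subst (d ∣_) (sym Q≡) (∣m⇒∣m*n (suc (2+ n)) d∣Q′))

-- From 4 ≡ 1 modulo 3, 4^j = 1 + r with 3 dividing r, so that 1 + 2 · 4^j = 3 + 2 r.
3∣1+2^odd : ∀ j → 3 ∣ suc (2 ^ suc (j * 2))
3∣1+2^odd j with ≡1-^ {4} {3} j (3 , refl , ∣-refl)
... | r , eq , 3∣r = subst (3 ∣_) 3+2r≡ (∣m∣n⇒∣m+n ∣-refl (∣n⇒∣m*n 2 3∣r))
  where
  open ≡-Reasoning
  3+2r≡ : 3 + 2 * r ≡ suc (2 ^ suc (j * 2))
  3+2r≡ = cong suc (begin
    2 + 2 * r       ≡⟨ *-suc 2 r ⟨
    2 * suc r       ≡⟨ cong (2 *_) eq ⟨
    2 * 4 ^ j       ≡⟨ cong (2 *_) (^-*-assoc 2 2 j) ⟩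
    2 * 2 ^ (2 * j) ≡⟨ cong (λ e → 2 * 2 ^ e) (*-comm 2 j) ⟩
    2 ^ suc (j * 2) ∎)

-- The recursion reads 3 g₃ = g₂ (2 + g₂^K), and here 3 divides g₂ = 1 + 2^K.
göbel₃-odd : ∀ j → ∃[ g ] göbel (2+ (j * 2)) 3 ≡ fromℕ-ℚ g
göbel₃-odd j with 3∣1+2^odd j
... | divides t eq = t * (2 + g ^ K) , göbel-suc (suc K) 1 g (t * (2 + g ^ K)) (göbel₂ K) (begin
    2 * g + g * g ^ K     ≡⟨ cong (_+ g * g ^ K) (*-comm 2 g) ⟩
    g * 2 + g * g ^ K     ≡⟨ *-distribˡ-+ g 2 (g ^ K) ⟨
    g * (2 + g ^ K)       ≡⟨ cong (_* (2 + g ^ K)) (trans eq (*-comm t 3)) ⟩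
    3 * t * (2 + g ^ K)   ≡⟨ *-assoc 3 t (2 + g ^ K) ⟩
    3 * (t * (2 + g ^ K)) ∎)
  where
  open ≡-Reasoning
  K g : ℕ
  K = suc (j * 2)
  g = suc (2 ^ K)

2∤⇒odd : ∀ {n} → 2 ∤ n → ∃[ j ] n ≡ suc (j * 2)
2∤⇒odd {zero} 2∤n = contradiction (2 ∣0) 2∤n
2∤⇒odd {suc n} 2∤1+n with 2∣n⊎2∣1+n n
... | inj₁ (divides j eq) = j , cong suc eq
... | inj₂ 2∣1+n = contradiction 2∣1+n 2∤1+n

2∣compositorial : ∀ {m} → 4 ≤ m → 2 ∣ compositorial m
2∣compositorial 4≤m = ∣-trans (divides 2 refl)
  (nonprime∣compositorial (composite⇒¬prime composite[4]) 4≤m)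

göbel-integral : ∀ m {K} .{{_ : NonZero K}} → compositorial m ∣ K →
  ∀ n .{{_ : NonZero n}} → n ≤ m → ∃[ g ] göbel (suc K) n ≡ fromℕ-ℚ g
göbel-integral _ C∣K 1 _ = 2 , refl
göbel-integral m {K} C∣K (2+ n) n≤m with 2 ∣? K
... | yes 2∣K with göbel-coprime m 2∣K C∣K n n≤m
...   | g , _ , eq , _ = g , eq
göbel-integral m {K} C∣K 2 n≤m | no _ = suc (2 ^ K) , göbel₂ K
göbel-integral m {K} C∣K 3 n≤m | no 2∤K with 2∤⇒odd 2∤K
... | j , refl = göbel₃-odd j
-- An index of at least 4 forces m ≥ 4, so 4 is a factor of the compositorial and `K` would be even.
göbel-integral m {K} C∣K (2+ (2+ n)) n≤m | no 2∤K =
  contradiction (∣-trans (2∣compositorial (≤-trans (s≤s (s≤s (s≤s (s≤s z≤n)))) n≤m)) C∣K) 2∤K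

-- The lower bound for N and its supremum

N>m : ∀ m {K} .{{_ : NonZero K}} → compositorial m ∣ K → ∀ N → IsN (suc K) N → [ m ] <⁺ N
N>m m C∣K ⊤⁺    _ = Strict.[ m ]<⊤⁺
-- Every non-integral index is at least m + 1, so the greatest lower bound is too; m + 1 ≤ n is by
-- definition m < n.
N>m m {K} C∣K [ n ] (_ , greatest) with greatest [ suc m ] lower
  where
  lower : ∀ y → NonIntegralIndex (suc K) y → [ suc m ] ≤⁺ y
  lower _ (i , i≢0 , refl , ∉ℤ) = ≤[ ≰⇒> (λ i≤m →
    let g , eq = göbel-integral m C∣K i {{i≢0}} i≤m in ∉ℤ (ℤ.+ g , eq)) ]
... | ≤[ m<n ] = Strict.[ m<n ]

mainTheorem1 : (∀ (m : ℕ) → 1 ≤ m →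
    ∀ (k : ℕ) → 2 ≤ k → k ≡ 1 [mod (m ! / m #) {{m #≢0}} ] →
    ∀ N → IsN k N → [ m ] <⁺ N)
    × IsSup (λ x → ∃[ k ] (2 ≤ k × IsN k x)) ⊤⁺
mainTheorem1 = bound , (λ y _ → y ≤⊤⁺) , least
  where
  bound : ∀ (m : ℕ) → 1 ≤ m →
    ∀ (k : ℕ) → 2 ≤ k → k ≡ 1 [mod (m ! / m #) {{m #≢0}} ] →
    ∀ N → IsN k N → [ m ] <⁺ N
  bound m _ 1 (s≤s ())
  -- Integer divisibility compares absolute values, so the congruence for k = j + 2 computes to
  -- divisibility of `suc j` in ℕ.
  bound m _ (2+ j) _ k≡1 = N>m m (subst (_∣ suc j) (!/#≡compositorial m) k≡1)

  least : ∀ u → (∀ y → ∃[ k ] (2 ≤ k × IsN k y) → y ≤⁺ u) → ⊤⁺ ≤⁺ u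
  least ⊤⁺    _  = ⊤⁺ ≤⊤⁺
  -- A finite upper bound m is refuted by k = K + 1 with `K` the compositorial of m. The value N_k
  -- is available only up to double negation, which suffices for a contradiction.
  least [ m ] ub = contradiction unbounded (N-¬¬exists (suc K))
    where
    K : ℕ
    K = compositorial m
    instance _ = compositorial≢0 m
    2≤1+K : 2 ≤ suc K
    2≤1+K = s≤s (>-nonZero⁻¹ K)
    unbounded : ¬ (∃[ x ] IsN (suc K) x)
    unbounded (x , isN) with N>m m ∣-refl x isN | ub x (suc K , 2≤1+K , isN)
    ... | Strict.[ m<n ] | ≤[ n≤m ] = <⇒≱ m<n n≤m
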